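{- Let $1\le k\le d$ and let $\mu$ be a probability distribution on $Q_d$ with $w_i^0\ge \frac34-\frac1{4k}$ for all $i\in[d]$. Then $(\mathbf 0,\mathbf 0)$ is a $k$-local equilibrium.
   Context: $Q_d=\{0,1\}^d$ with the Hamming distance $d(X,Y)=|\{i: x_i\neq y_i\}|$. A probability distribution on $Q_d$ is a function $\mu:Q_d\to\mathbb R_{\ge0}$ with $\sum_{V\in Q_d}\mu(V)=1$, extended to subsets by $\mu(\mathcal A)=\sum_{V\in\mathcal A}\mu(V)$. For $A,B\in Q_d$ let $V(A,B)=\{X\in Q_d: d(X,A)<d(X,B)\}$ and $T(A,B)=\{X\in Q_d: d(X,A)=d(X,B)\}$. The payoffs in position $(A,B)$ are $P_1(A,B)=\mu(V(A,B))+\frac12\mu(T(A,B))$ and $P_2(A,B)=\mu(V(B,A))+\frac12\mu(T(A,B))$. The pair $(A,B)$ is a $k$-local equilibrium if $P_1(A,B)\ge P_1(A',B)$ for all $A'\in Q_d$ with $d(A,A')\le k$ and $P_2(A,B)\ge P_2(A,B')$ for all $B'\in Q_d$ with $d(B,B')\le k$. For $i\in[d]$, $w_i^0=\mu(\{X\in Q_d: x_i=0\})$. $\mathbf 0=(0,\dots,0)$. -}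

module Defs where

open import Algebra.Bundles using (CommutativeMonoid)
import Algebra.Properties.CommutativeSemigroup as CommutativeSemigroupProperties
open import Data.Fin using (Fin)
open import Data.Fin.Patterns using (0F; 1F)
open import Data.Fin.Properties using (_≟_)
import Data.Integer as ℤ
open import Data.List as List using (List; _++_; filter; foldr)
open import Data.Nat as ℕ using (ℕ; zero; suc)
import Data.Nat.Properties as ℕₚ
open import Data.Product using (_×_; _,_; ∃)
open import Data.Rational using (ℚ; 0ℚ; 1ℚ; ½; _+_; _*_; _-_; -_; ∣_∣; _<_; _≤_; _/_; 1/_; NonZero; Positive; positive; nonNegative)
open import Data.Rational.Properties as ℚₚ using (module ≤-Reasoning)
open import Data.Vec using (Vec; []; _∷_; allFin; count; lookup; replicate)
open import Relation.Binary.PropositionalEquality using (_≡_; sym; trans; cong; subst)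
open import Relation.Nullary using (¬?)
open import Relation.Unary using (Pred; Decidable)
open import Level using (0ℓ)

-- The real numbers, as Cauchy sequences of rationals.  Equality of reals
-- is the setoid equality _≈ᴿ_.

IsCauchy : (ℕ → ℚ) → Set
IsCauchy s = ∀ ε → 0ℚ < ε → ∃ λ N → ∀ m n → N ℕ.≤ m → N ℕ.≤ n → ∣ s m - s n ∣ < ε

record ℝ : Set where
  constructor mkℝ
  field
    seq    : ℕ → ℚ
    cauchy : IsCauchy seq

open ℝ public

infix 4 _≈ᴿ_ _≤ᴿ_ _≥ᴿ_

_≈ᴿ_ : ℝ → ℝ → Set
x ≈ᴿ y = ∀ ε → 0ℚ < ε → ∃ λ N → ∀ n → N ℕ.≤ n → ∣ seq x n - seq y n ∣ < ε

-- The slack ε makes this the non-strict order of the limits; the sequences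
-- themselves need not eventually be ordered termwise.
_≤ᴿ_ : ℝ → ℝ → Set
x ≤ᴿ y = ∀ ε → 0ℚ < ε → ∃ λ N → ∀ n → N ℕ.≤ n → seq x n < seq y n + ε

_≥ᴿ_ : ℝ → ℝ → Set
x ≥ᴿ y = y ≤ᴿ x

fromℚ : ℚ → ℝ
fromℚ q = mkℝ (λ _ → q) λ ε 0<ε → 0 , λ _ _ _ _ →
  subst (_< ε) (sym (cong ∣_∣ (ℚₚ.+-inverseʳ q))) 0<ε

0ᴿ 1ᴿ : ℝ
0ᴿ = fromℚ 0ℚ
1ᴿ = fromℚ 1ℚ

private
  halves : ∀ ε → ½ * ε + ½ * ε ≡ ε
  halves ε = trans (sym (ℚₚ.*-distribʳ-+ ε ½ ½)) (ℚₚ.*-identityˡ ε)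

  half-pos : ∀ {ε} → 0ℚ < ε → 0ℚ < ½ * ε
  half-pos {ε} 0<ε = ℚₚ.positive⁻¹ (½ * ε) {{ℚₚ.pos*pos⇒pos ½ ε {{positive 0<ε}}}}

  regroup : ∀ a b c d → (a + b) - (c + d) ≡ (a - c) + (b - d)
  regroup a b c d = trans (cong ((a + b) +_) (ℚₚ.neg-distrib-+ c d)) (interchange a b (- c) (- d))
    where open CommutativeSemigroupProperties (CommutativeMonoid.commutativeSemigroup ℚₚ.+-0-commutativeMonoid)

  factor : ∀ q a b → q * a - q * b ≡ q * (a - b)
  factor q a b = trans (cong (q * a +_) (ℚₚ.neg-distribʳ-* q b)) (sym (ℚₚ.*-distribˡ-+ q a (- b)))

infixl 6 _+ᴿ_

_+ᴿ_ : ℝ → ℝ → ℝ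
x +ᴿ y = mkℝ (λ n → seq x n + seq y n) isCauchy
  where
  open ≤-Reasoning
  isCauchy : IsCauchy (λ n → seq x n + seq y n)
  isCauchy ε 0<ε with cauchy x (½ * ε) (half-pos 0<ε) | cauchy y (½ * ε) (half-pos 0<ε)
  ... | M , p | N , q = M ℕ.⊔ N , λ m n M⊔N≤m M⊔N≤n → begin-strict
    ∣ (seq x m + seq y m) - (seq x n + seq y n) ∣
      ≡⟨ cong ∣_∣ (regroup (seq x m) (seq y m) (seq x n) (seq y n)) ⟩
    ∣ (seq x m - seq x n) + (seq y m - seq y n) ∣
      ≤⟨ ℚₚ.∣p+q∣≤∣p∣+∣q∣ (seq x m - seq x n) (seq y m - seq y n) ⟩
    ∣ seq x m - seq x n ∣ + ∣ seq y m - seq y n ∣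
      <⟨ ℚₚ.+-mono-< (p m n (ℕₚ.m⊔n≤o⇒m≤o M N M⊔N≤m) (ℕₚ.m⊔n≤o⇒m≤o M N M⊔N≤n))
                     (q m n (ℕₚ.m⊔n≤o⇒n≤o M N M⊔N≤m) (ℕₚ.m⊔n≤o⇒n≤o M N M⊔N≤n)) ⟩
    ½ * ε + ½ * ε
      ≡⟨ halves ε ⟩
    ε ∎

infixr 7 _·ᴿ_

_·ᴿ_ : ℚ → ℝ → ℝ
q ·ᴿ x = mkℝ (λ n → q * seq x n) isCauchy
  where
  open ≤-Reasoning
  c : ℚ
  c = 1ℚ + ∣ q ∣

  instance
    c-pos : Positive c
    c-pos = ℚₚ.pos+nonNeg⇒pos 1ℚ ∣ q ∣ {{nonNegative (ℚₚ.0≤∣p∣ q)}}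

    c-nonZero : NonZero c
    c-nonZero = ℚₚ.pos⇒nonZero c

  ∣q∣≤c : ∣ q ∣ ≤ c
  ∣q∣≤c = subst (_≤ c) (ℚₚ.+-identityˡ ∣ q ∣)
    (ℚₚ.+-monoˡ-≤ ∣ q ∣ (ℚₚ.<⇒≤ (ℚₚ.positive⁻¹ 1ℚ)))

  isCauchy : IsCauchy (λ n → q * seq x n)
  isCauchy ε 0<ε
    with cauchy x (1/ c * ε)
           (ℚₚ.positive⁻¹ (1/ c * ε)
             {{ℚₚ.pos*pos⇒pos (1/ c) {{ℚₚ.1/pos⇒pos c}} ε {{positive 0<ε}}}})
  ... | N , p = N , λ m n N≤m N≤n → begin-strict
    ∣ q * seq x m - q * seq x n ∣
      ≡⟨ cong ∣_∣ (factor q (seq x m) (seq x n)) ⟩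
    ∣ q * (seq x m - seq x n) ∣
      ≡⟨ ℚₚ.∣p*q∣≡∣p∣*∣q∣ q (seq x m - seq x n) ⟩
    ∣ q ∣ * ∣ seq x m - seq x n ∣
      ≤⟨ ℚₚ.*-monoʳ-≤-nonNeg ∣ seq x m - seq x n ∣
           {{nonNegative (ℚₚ.0≤∣p∣ (seq x m - seq x n))}} ∣q∣≤c ⟩
    c * ∣ seq x m - seq x n ∣
      <⟨ ℚₚ.*-monoʳ-<-pos c (p m n N≤m N≤n) ⟩
    c * (1/ c * ε)
      ≡⟨ ℚₚ.*-assoc c (1/ c) ε ⟨
    c * 1/ c * ε
      ≡⟨ cong (_* ε) (ℚₚ.*-inverseʳ c) ⟩
    1ℚ * ε
      ≡⟨ ℚₚ.*-identityˡ ε ⟩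
    ε ∎

sumᴿ : List ℝ → ℝ
sumᴿ = foldr _+ᴿ_ 0ᴿ

Q : ℕ → Set
Q d = Vec (Fin 2) d

𝟎 : ∀ {d} → Q d
𝟎 {d} = replicate d 0F

vertices : ∀ d → List (Q d)
vertices zero    = [] List.∷ List.[]
vertices (suc d) = List.map (0F ∷_) (vertices d) ++ List.map (1F ∷_) (vertices d)

dist : ∀ {d} → Q d → Q d → ℕ
dist {d} X Y = count (λ i → ¬? (lookup X i ≟ lookup Y i)) (allFin d)

record IsProbability {d : ℕ} (μ : Q d → ℝ) : Set where
  field
    nonNeg : ∀ X → 0ᴿ ≤ᴿ μ X
    total  : sumᴿ (List.map μ (vertices d)) ≈ᴿ 1ᴿ

-- μ(𝒜), for a subset 𝒜 of the cube given by a decidable predicate.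
mass : ∀ {d} → (Q d → ℝ) → {𝒜 : Pred (Q d) 0ℓ} → Decidable 𝒜 → ℝ
mass {d} μ 𝒜? = sumᴿ (List.map μ (filter 𝒜? (vertices d)))

w⁰ : ∀ {d} → (Q d → ℝ) → Fin d → ℝ
w⁰ μ i = mass μ (λ X → lookup X i ≟ 0F)

V : ∀ {d} → Q d → Q d → Pred (Q d) 0ℓ
V A B X = dist X A ℕ.< dist X B

V? : ∀ {d} (A B : Q d) → Decidable (V A B)
V? A B X = dist X A ℕ.<? dist X B

T : ∀ {d} → Q d → Q d → Pred (Q d) 0ℓ
T A B X = dist X A ≡ dist X B

T? : ∀ {d} (A B : Q d) → Decidable (T A B)
T? A B X = dist X A ℕ.≟ dist X B

P₁ P₂ : ∀ {d} → (Q d → ℝ) → Q d → Q d → ℝ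
P₁ μ A B = mass μ (V? A B) +ᴿ ½ ·ᴿ mass μ (T? A B)
P₂ μ A B = mass μ (V? B A) +ᴿ ½ ·ᴿ mass μ (T? A B)

IsLocalEquilibrium : ∀ {d} → ℕ → (Q d → ℝ) → Q d → Q d → Set
IsLocalEquilibrium {d} k μ A B =
  (∀ (A′ : Q d) → dist A A′ ℕ.≤ k → P₁ μ A B ≥ᴿ P₁ μ A′ B) ×
  (∀ (B′ : Q d) → dist B B′ ℕ.≤ k → P₂ μ A B ≥ᴿ P₂ μ A B′)

threshold : (k : ℕ) .{{_ : ℕ.NonZero k}} → ℚ
threshold k = ℤ.+ 3 / 4 - (ℤ.+ 1 / (4 ℕ.* k)) {{ℕₚ.m*n≢0 4 k}}

{-# OPTIONS --safe #-}

-- Let A be a vertex with s ones, 1 ≤ s ≤ k, and let j(X) be the number of ones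
-- that X and A share.  Against 𝟎, the vertex A wins X iff s < 2 j(X) and ties iff
-- s = 2 j(X), so its share g(X) ∈ {0, ½, 1} of X satisfies (s + 1) g(X) ≤ 2 j(X).
-- The hypothesis gives E[xᵢ] ≤ (k + 1) / 4k, hence E[j] ≤ s (k + 1) / 4k and
-- E[g] ≤ s (k + 1) / (2 k (s + 1)) ≤ ½, which is the payoff of 𝟎 against itself.
-- Clearing denominators, only natural multiples of real numbers are needed.

module Submission where

open import Defs
open import Algebra.Bundles using (CommutativeMonoid)
import Algebra.Properties.CommutativeMonoid.Mult as Mult
import Algebra.Properties.CommutativeSemigroup as CommutativeSemigroupProperties
import Algebra.Properties.Group as GroupProperties
open import Data.Bool using (true; false; not; if_then_else_)
open import Data.Fin using (Fin; zero; suc; toℕ)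
open import Data.Fin.Patterns using (0F; 1F)
import Data.Fin.Properties as Finₚ
import Data.Integer as ℤ
import Data.Integer.Properties as ℤₚ
open import Data.List as List using (List; []; _∷_; filter)
open import Data.List.Properties using (filter-≐)
open import Data.Nat using (ℕ; zero; suc; _≤_; _<_; z≤n; s≤s; NonZero; _+_; _*_; _⊔_)
import Data.Nat.Properties as ℕₚ
open import Algebra.Properties.Monoid.Sum ℕₚ.+-0-monoid using () renaming (sum to ∑)
open import Data.Nat.Tactic.RingSolver using (solve-∀)
open import Data.Product as Product using (_,_; proj₁)
open import Data.Rational as ℚ using (ℚ; 0ℚ; 1ℚ; ½)
import Data.Rational.Properties as ℚₚ
import Data.Rational.Unnormalised as ℚᵘ
import Data.Rational.Unnormalised.Properties as ℚᵘₚ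
open import Data.Sum using (inj₁; inj₂)
open import Data.Vec as Vec using ([]; _∷_; lookup)
open import Function using (_∘_; flip; id)
open import Level using (0ℓ)
open import Relation.Binary.Bundles using (Preorder)
open import Relation.Binary.Structures using (IsEquivalence; IsPreorder)
open import Relation.Binary.PropositionalEquality using (_≡_; refl; sym; trans; cong; subst; subst₂; module ≡-Reasoning)
import Relation.Binary.Reasoning.Preorder as PreorderReasoning
open import Relation.Nullary using (Dec; yes; no; does; ¬?; contradiction)
open import Relation.Unary using (Pred; Decidable)

-- The expectation argument is carried out over an abstract ordered monoid, since
-- the operations on ℝ unfold to sequences and defeat unification.
record OrderedMonoid : Set₁ where
  infix 4 _≲_
  field
    commutativeMonoid : CommutativeMonoid 0ℓ 0ℓ

  open CommutativeMonoid commutativeMonoid public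
    using (Carrier; _≈_; commutativeSemigroup)
    renaming ( _∙_ to infixl 6 _⊕_; ε to 0#; ∙-cong to ⊕-cong; ∙-congˡ to ⊕-congˡ; ∙-congʳ to ⊕-congʳ
             ; assoc to ⊕-assoc; comm to ⊕-comm; identityˡ to ⊕-identityˡ)
  module Eq = CommutativeMonoid commutativeMonoid using (refl; sym; trans)
  open Mult commutativeMonoid public

  field
    _≲_         : Carrier → Carrier → Set
    isPreorder  : IsPreorder _≈_ _≲_
    ⊕-mono-≲    : ∀ {x y u v} → x ≲ y → u ≲ v → (x ⊕ u) ≲ (y ⊕ v)
    ⊕-cancelʳ-≲ : ∀ {x y} z → (x ⊕ z) ≲ (y ⊕ z) → x ≲ y
    ×-cancelˡ-≲ : ∀ n {x y} → (suc n × x) ≲ (suc n × y) → x ≲ y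
    half        : Carrier → Carrier
    2×half      : ∀ x → (2 × half x) ≈ x

  preorder : Preorder 0ℓ 0ℓ 0ℓ
  preorder = record { isPreorder = isPreorder }

  open Preorder preorder public using () renaming (refl to ≲-refl; reflexive to ≲-reflexive; trans to ≲-trans)
  module ≲-Reasoning = PreorderReasoning preorder

  ×-monoʳ-≲ : ∀ n {x y} → x ≲ y → n × x ≲ n × y
  ×-monoʳ-≲ zero    x≲y = ≲-refl
  ×-monoʳ-≲ (suc n) x≲y = ⊕-mono-≲ x≲y (×-monoʳ-≲ n x≲y)

  0≲n×x : ∀ n {x} → 0# ≲ x → 0# ≲ n × x
  0≲n×x zero    0≲x = ≲-refl
  0≲n×x (suc n) {x} 0≲x = begin
    0#            ≈⟨ ⊕-identityˡ 0# ⟨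
    0# ⊕ 0#       ≲⟨ ⊕-mono-≲ 0≲x (0≲n×x n 0≲x) ⟩
    x ⊕ n × x     ∎
    where open ≲-Reasoning

  ×-monoˡ-≲ : ∀ {m n x} → 0# ≲ x → m ≤ n → m × x ≲ n × x
  ×-monoˡ-≲ {n = n} 0≲x z≤n       = 0≲n×x n 0≲x
  ×-monoˡ-≲         0≲x (s≤s m≤n) = ⊕-mono-≲ ≲-refl (×-monoˡ-≲ 0≲x m≤n)

  ×-comm : ∀ m n x → m × (n × x) ≈ n × (m × x)
  ×-comm m n x = Eq.trans (×-assocˡ x m n) (Eq.trans (×-congˡ (ℕₚ.*-comm m n)) (Eq.sym (×-assocˡ x n m)))

  sumOf : List Carrier → Carrier
  sumOf = List.foldr _⊕_ 0#

-- Expectations of ℕ-valued functions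

-- Valued in ℕ, so that an expectation needs only natural multiples of the weights.
𝟙 : {Ω : Set} {P : Pred Ω 0ℓ} → Decidable P → Ω → ℕ
𝟙 P? X = if does (P? X) then 1 else 0

module Expectation (M : OrderedMonoid) {Ω : Set} (μ : Ω → OrderedMonoid.Carrier M) where

  open OrderedMonoid M
  module CS = CommutativeSemigroupProperties commutativeSemigroup

  -- The list is left arbitrary for the sake of induction; it becomes the whole cube in `E`.
  Σμ : List Ω → (Ω → ℕ) → Carrier
  Σμ L f = sumOf (List.map (λ X → f X × μ X) L)

  Σμ-mono : (∀ X → 0# ≲ μ X) → ∀ L {f g} → (∀ X → f X ≤ g X) → Σμ L f ≲ Σμ L g
  Σμ-mono 0≲μ []      f≤g = ≲-refl
  Σμ-mono 0≲μ (X ∷ L) f≤g = ⊕-mono-≲ (×-monoˡ-≲ (0≲μ X) (f≤g X)) (Σμ-mono 0≲μ L f≤g)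

  Σμ-cong : ∀ L {f g} → (∀ X → f X ≡ g X) → Σμ L f ≈ Σμ L g
  Σμ-cong []      f≡g = Eq.refl
  Σμ-cong (X ∷ L) f≡g = ⊕-cong (×-congˡ (f≡g X)) (Σμ-cong L f≡g)

  Σμ-0 : ∀ L → Σμ L (λ _ → 0) ≈ 0#
  Σμ-0 []      = Eq.refl
  Σμ-0 (X ∷ L) = Eq.trans (⊕-congˡ (Σμ-0 L)) (⊕-identityˡ 0#)

  Σμ-+ : ∀ L f g → Σμ L (λ X → f X + g X) ≈ Σμ L f ⊕ Σμ L g
  Σμ-+ []      f g = Eq.sym (⊕-identityˡ 0#)
  Σμ-+ (X ∷ L) f g = Eq.trans (⊕-cong (×-homo-+ (μ X) (f X) (g X)) (Σμ-+ L f g))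
    (CS.interchange (f X × μ X) (g X × μ X) (Σμ L f) (Σμ L g))

  Σμ-* : ∀ L n f → Σμ L (λ X → n * f X) ≈ n × Σμ L f
  Σμ-* L zero    f = Σμ-0 L
  Σμ-* L (suc n) f = Eq.trans (Σμ-+ L f (λ X → n * f X)) (⊕-congˡ (Σμ-* L n f))

  Σμ-1 : ∀ L → sumOf (List.map μ L) ≈ Σμ L (λ _ → 1)
  Σμ-1 []      = Eq.refl
  Σμ-1 (X ∷ L) = ⊕-cong (Eq.sym (×-homo-1 (μ X))) (Σμ-1 L)

  -- Dropping an element and taking its weight 0 times contribute the same, so every mass is the
  -- expectation of an indicator.
  Σμ-𝟙 : ∀ L {P : Pred Ω 0ℓ} (P? : Decidable P) → sumOf (List.map μ (filter P? L)) ≈ Σμ L (𝟙 P?)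
  Σμ-𝟙 []      P? = Eq.refl
  Σμ-𝟙 (X ∷ L) P? with does (P? X)
  ... | true  = ⊕-cong (Eq.sym (×-homo-1 (μ X))) (Σμ-𝟙 L P?)
  ... | false = Eq.trans (Σμ-𝟙 L P?) (Eq.sym (⊕-identityˡ _))

  -- Linearity of expectation, with the factor `c` kept on the left in place of a division. With `a`
  -- the coordinates of A and `f` those of X, it bounds the expectation of `shared A`.
  Σμ-weighted-≲ : ∀ L {d} c r (a : Fin d → ℕ) (f : Fin d → Ω → ℕ) →
    (∀ i → c × Σμ L (f i) ≲ r) →
    c × Σμ L (λ X → ∑ (λ i → a i * f i X)) ≲ ∑ a × r
  Σμ-weighted-≲ L {zero} c r a f f≲r = begin
    c × Σμ L (λ _ → 0)          ≈⟨ ×-congʳ c (Σμ-0 L) ⟩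
    c × (0 × r)                 ≈⟨ ×-assocˡ r c 0 ⟩
    (c * 0) × r                 ≈⟨ ×-congˡ (ℕₚ.*-zeroʳ c) ⟩
    0 × r                       ∎
    where open ≲-Reasoning
  Σμ-weighted-≲ L {suc d} c r a f f≲r = begin
    c × Σμ L (λ X → a 0F * f 0F X + rest X)
      ≈⟨ ×-congʳ c (Σμ-+ L (λ X → a 0F * f 0F X) rest) ⟩
    c × (Σμ L (λ X → a 0F * f 0F X) ⊕ Σμ L rest)
      ≈⟨ ×-distrib-+ _ _ c ⟩
    c × Σμ L (λ X → a 0F * f 0F X) ⊕ c × Σμ L rest
      ≈⟨ ⊕-congʳ (×-congʳ c (Σμ-* L (a 0F) (f 0F))) ⟩
    c × (a 0F × Σμ L (f 0F)) ⊕ c × Σμ L rest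
      ≈⟨ ⊕-congʳ (×-comm c (a 0F) (Σμ L (f 0F))) ⟩
    a 0F × (c × Σμ L (f 0F)) ⊕ c × Σμ L rest
      ≲⟨ ⊕-mono-≲ (×-monoʳ-≲ (a 0F) (f≲r 0F)) (Σμ-weighted-≲ L c r (a ∘ suc) (f ∘ suc) (f≲r ∘ suc)) ⟩
    a 0F × r ⊕ ∑ (a ∘ suc) × r
      ≈⟨ ×-homo-+ r (a 0F) (∑ (a ∘ suc)) ⟨
    ∑ a × r ∎
    where
    open ≲-Reasoning
    rest : Ω → ℕ
    rest X = ∑ (λ i → a (suc i) * f (suc i) X)

-- Hamming distances

-- A count depends only on the Booleans of the decisions. This lets `dist-∷` compare the positions
-- `suc i` of a longer vector with `allFin`.
count-tabulate-cong : ∀ {A B : Set} {n} {P : Pred A 0ℓ} {R : Pred B 0ℓ} (P? : Decidable P) (R? : Decidable R)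
  (f : Fin n → A) (g : Fin n → B) → (∀ i → does (P? (f i)) ≡ does (R? (g i))) →
  Vec.count P? (Vec.tabulate f) ≡ Vec.count R? (Vec.tabulate g)
count-tabulate-cong {n = zero}  P? R? f g eq = refl
count-tabulate-cong {n = suc n} P? R? f g eq
  rewrite eq 0F | count-tabulate-cong P? R? (f ∘ suc) (g ∘ suc) (eq ∘ suc) = refl

distinct : Fin 2 → Fin 2 → ℕ
distinct x y = if does (x Finₚ.≟ y) then 0 else 1

-- `dist` counts positions in `allFin`; this recursion opens it to induction on vectors.
dist-∷ : ∀ {d} x y (X Y : Q d) → dist (x ∷ X) (y ∷ Y) ≡ distinct x y + dist X Y
dist-∷ x y X Y = go (does (x Finₚ.≟ y))
  where
  n = Vec.count (λ i → ¬? (lookup (x ∷ X) i Finₚ.≟ lookup (y ∷ Y) i)) (Vec.tabulate suc)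

  n≡dist : n ≡ dist X Y
  n≡dist = count-tabulate-cong (λ i → ¬? (lookup (x ∷ X) i Finₚ.≟ lookup (y ∷ Y) i))
    (λ i → ¬? (lookup X i Finₚ.≟ lookup Y i)) suc id λ _ → refl

  -- The left side is what `count` reduces to on a nonempty vector, with the outcome of the head
  -- comparison generalised to `b`.
  go : ∀ b → (if not b then suc else id) n ≡ (if b then 0 else 1) + dist X Y
  go true  = n≡dist
  go false = cong suc n≡dist

ones : ∀ {d} → Q d → Fin d → ℕ
ones X i = toℕ (lookup X i)

-- This is j(X), in the form that `Σμ-weighted-≲` takes: coordinates of X weighted by those of A.
shared : ∀ {d} → Q d → Q d → ℕ
shared A X = ∑ λ i → ones A i * ones X i

dist-𝟎ˡ : ∀ {d} (A : Q d) → dist 𝟎 A ≡ ∑ (ones A)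
dist-𝟎ˡ []       = refl
dist-𝟎ˡ (0F ∷ A) = trans (dist-∷ 0F 0F 𝟎 A) (dist-𝟎ˡ A)
dist-𝟎ˡ (1F ∷ A) = trans (dist-∷ 0F 1F 𝟎 A) (cong suc (dist-𝟎ˡ A))

shared≤∑ones : ∀ {d} (A X : Q d) → shared A X ≤ ∑ (ones A)
shared≤∑ones []       []       = z≤n
shared≤∑ones (0F ∷ A) (x  ∷ X) = shared≤∑ones A X
shared≤∑ones (1F ∷ A) (0F ∷ X) = ℕₚ.m≤n⇒m≤1+n (shared≤∑ones A X)
shared≤∑ones (1F ∷ A) (1F ∷ X) = s≤s (shared≤∑ones A X)

-- In terms of sets of coordinates: ∣X ∆ A∣ + 2 ∣A ∩ X∣ = ∣X∣ + ∣A∣.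
dist-shared : ∀ {d} (A X : Q d) → dist X A + 2 * shared A X ≡ dist X 𝟎 + ∑ (ones A)
dist-shared []      []      = refl
dist-shared (a ∷ A) (x ∷ X)
  rewrite dist-∷ x a X A | dist-∷ x 0F X 𝟎 = step a x (dist-shared A X)
  where
  step : ∀ a x {p q r s} → p + 2 * q ≡ r + s →
    (distinct x a + p) + 2 * (toℕ a * toℕ x + q) ≡ (distinct x 0F + r) + (toℕ a + s)
  step 0F 0F eq = eq
  step 0F 1F eq = cong suc eq
  step 1F 0F {r = r} {s} eq = trans (cong suc eq) (sym (ℕₚ.+-suc r s))
  step 1F 1F {p} {q} {r} {s} eq = trans (shift p q) (trans (cong (2 +_) eq) (cong suc (sym (ℕₚ.+-suc r s))))
    where
    shift : ∀ p q → p + 2 * (1 + q) ≡ 2 + (p + 2 * q)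
    shift = solve-∀

-- Shares of a single vertex X, doubled to stay in ℕ

doubleShare : ∀ {d} → Q d → Q d → Q d → ℕ
doubleShare A B X = 2 * 𝟙 (V? A B) X + 𝟙 (T? A B) X

1≤doubleShare-diagonal : ∀ {d} (A X : Q d) → 1 ≤ doubleShare A A X
1≤doubleShare-diagonal A X = go (T? A A X)
  where
  go : (t? : Dec (T A A X)) → 1 ≤ 2 * 𝟙 (V? A A) X + (if does t? then 1 else 0)
  go (yes _) = ℕₚ.m≤n+m 1 (2 * 𝟙 (V? A A) X)
  go (no ¬t) = contradiction refl ¬t

-- If 2j were at most the number of ones of A, a win would make the left side of `dist-shared`
-- smaller than the right.
V⇒∑ones<2shared : ∀ {d} (A X : Q d) → V A 𝟎 X → ∑ (ones A) < 2 * shared A X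
V⇒∑ones<2shared A X v = ℕₚ.≰⇒> λ 2j≤s → ℕₚ.<-irrefl (dist-shared A X) (ℕₚ.+-mono-<-≤ v 2j≤s)

T⇒∑ones≡2shared : ∀ {d} (A X : Q d) → T A 𝟎 X → ∑ (ones A) ≡ 2 * shared A X
T⇒∑ones≡2shared A X t = ℕₚ.+-cancelˡ-≡ (dist X 𝟎) _ _
  (trans (sym (dist-shared A X)) (cong (_+ 2 * shared A X) t))

-- The case A = 𝟎 stands apart because (s + 1) g ≤ 2j fails there: every X ties and j = 0. As j
-- never exceeds s = 0, a win would require 0 < 0.
doubleShare≤1 : ∀ {d} (A : Q d) → ∑ (ones A) ≡ 0 → ∀ X → doubleShare A 𝟎 X ≤ 1
doubleShare≤1 A s≡0 X = go (V? A 𝟎 X) (T? A 𝟎 X)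
  where
  open ℕₚ.≤-Reasoning
  go : (v? : Dec (V A 𝟎 X)) (t? : Dec (T A 𝟎 X)) →
    2 * (if does v? then 1 else 0) + (if does t? then 1 else 0) ≤ 1
  go (no  _) (yes _) = s≤s z≤n
  go (no  _) (no  _) = z≤n
  go (yes v) _       = contradiction (V⇒∑ones<2shared A X v) (ℕₚ.≤⇒≯ (begin
    2 * shared A X    ≤⟨ ℕₚ.*-monoʳ-≤ 2 (shared≤∑ones A X) ⟩
    2 * ∑ (ones A)    ≡⟨ cong (2 *_) s≡0 ⟩
    0                 ≤⟨ z≤n ⟩
    ∑ (ones A)        ∎))

-- The bound on g, doubled. Here `suc s` is the number of ones, so the factor is one more than that.
-- A win or a tie compares `suc s` with 2j; a loss makes the left side 0.
[s+1]*doubleShare≤4*shared : ∀ {d} (A : Q d) {s} → ∑ (ones A) ≡ suc s → ∀ X →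
  suc (suc s) * doubleShare A 𝟎 X ≤ 4 * shared A X
[s+1]*doubleShare≤4*shared A {s} eq X = go (V? A 𝟎 X) (T? A 𝟎 X)
  where
  open ℕₚ.≤-Reasoning
  j = shared A X

  2j*2≡4j : ∀ j → 2 * j * 2 ≡ 4 * j
  2j*2≡4j = solve-∀

  2j+2j≡4j : ∀ j → 2 * j + 2 * j ≡ 4 * j
  2j+2j≡4j = solve-∀

  go : (v? : Dec (V A 𝟎 X)) (t? : Dec (T A 𝟎 X)) →
    suc (suc s) * (2 * (if does v? then 1 else 0) + (if does t? then 1 else 0)) ≤ 4 * j
  go (yes v) (yes t) = contradiction t (ℕₚ.<⇒≢ v)
  go (no  _) (no  _) = subst (_≤ 4 * j) (sym (ℕₚ.*-zeroʳ s)) z≤n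
  go (yes v) (no  _) = begin
    -- In ℕ the strict inequality `suc s < 2 * j` already says `suc (suc s) ≤ 2 * j`.
    suc (suc s) * 2       ≤⟨ ℕₚ.*-monoˡ-≤ 2 (subst (_< 2 * j) eq (V⇒∑ones<2shared A X v)) ⟩
    2 * j * 2             ≡⟨ 2j*2≡4j j ⟩
    4 * j                 ∎
  go (no  _) (yes t) = begin
    suc (suc s) * 1       ≡⟨ ℕₚ.*-identityʳ (suc (suc s)) ⟩
    -- A has at least one 1, so the summand 1 is at most `suc s`.
    1 + suc s             ≤⟨ ℕₚ.+-monoˡ-≤ (suc s) (s≤s z≤n) ⟩
    suc s + suc s         ≡⟨ cong (λ n → n + n) (trans (sym eq) (T⇒∑ones≡2shared A X t)) ⟩
    2 * j + 2 * j         ≡⟨ 2j+2j≡4j j ⟩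
    4 * j                 ∎

-- Payoffs as expected shares

module Payoffs (M : OrderedMonoid) where

  open OrderedMonoid M

  module _ {d : ℕ} (μ : Q d → Carrier) (0≲μ : ∀ X → 0# ≲ μ X)
    {1# : Carrier} (0≲1 : 0# ≲ 1#) (total : sumOf (List.map μ (vertices d)) ≈ 1#) where

    open Expectation M μ
    open ≲-Reasoning

    -- Over ℝ, massOf, payoff and w are definitionally mass μ, P₁ μ and w⁰ μ.
    massOf : {𝒜 : Pred (Q d) 0ℓ} → Decidable 𝒜 → Carrier
    massOf 𝒜? = sumOf (List.map μ (filter 𝒜? (vertices d)))

    payoff : Q d → Q d → Carrier
    payoff A B = massOf (V? A B) ⊕ half (massOf (T? A B))

    w : Fin d → Carrier
    w i = massOf (λ X → lookup X i Finₚ.≟ 0F)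

    E : (Q d → ℕ) → Carrier
    E = Σμ (vertices d)

    E-mono : ∀ {f g} → (∀ X → f X ≤ g X) → E f ≲ E g
    E-mono = Σμ-mono 0≲μ (vertices d)

    E-1 : E (λ _ → 1) ≈ 1#
    E-1 = Eq.trans (Eq.sym (Σμ-1 (vertices d))) total

    -- Doubling absorbs `half`, which leaves the expectation of a function with values in ℕ.
    2×payoff : ∀ A B → 2 × payoff A B ≈ E (doubleShare A B)
    2×payoff A B = begin-equality
      2 × (massOf (V? A B) ⊕ half (massOf (T? A B)))
        ≈⟨ ×-distrib-+ (massOf (V? A B)) (half (massOf (T? A B))) 2 ⟩
      2 × massOf (V? A B) ⊕ 2 × half (massOf (T? A B))
        ≈⟨ ⊕-cong (×-congʳ 2 (Σμ-𝟙 (vertices d) (V? A B)))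
                   (Eq.trans (2×half (massOf (T? A B))) (Σμ-𝟙 (vertices d) (T? A B))) ⟩
      2 × E (𝟙 (V? A B)) ⊕ E (𝟙 (T? A B))
        ≈⟨ ⊕-congʳ (Σμ-* (vertices d) 2 (𝟙 (V? A B))) ⟨
      E (λ X → 2 * 𝟙 (V? A B) X) ⊕ E (𝟙 (T? A B))
        ≈⟨ Σμ-+ (vertices d) (λ X → 2 * 𝟙 (V? A B) X) (𝟙 (T? A B)) ⟨
      E (doubleShare A B) ∎

    -- A coordinate and the indicator of its being 0 add up to 1; a lower bound on `w i` thus
    -- becomes an upper bound on the expected coordinate.
    E-ones+w : ∀ i → E (λ X → ones X i) ⊕ w i ≈ 1#
    E-ones+w i = begin-equality
      E (λ X → ones X i) ⊕ w i
        ≈⟨ ⊕-congˡ (Σμ-𝟙 (vertices d) (λ X → lookup X i Finₚ.≟ 0F)) ⟩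
      E (λ X → ones X i) ⊕ E (𝟙 (λ X → lookup X i Finₚ.≟ 0F))
        ≈⟨ Σμ-+ (vertices d) (λ X → ones X i) (𝟙 (λ X → lookup X i Finₚ.≟ 0F)) ⟨
      E (λ X → ones X i + 𝟙 (λ X → lookup X i Finₚ.≟ 0F) X)
        ≈⟨ Σμ-cong (vertices d) (λ X → one-or-zero (lookup X i)) ⟩
      E (λ _ → 1)
        ≈⟨ E-1 ⟩
      1# ∎
      where
      one-or-zero : ∀ (x : Fin 2) → toℕ x + (if does (x Finₚ.≟ 0F) then 1 else 0) ≡ 1
      one-or-zero 0F = refl
      one-or-zero 1F = refl

    -- The radius is K = `suc k`. The equation `4kt+1≈3k` is t = 3/4 - 1/(4K) with denominators
    -- cleared.
    module _ (k : ℕ) (t : Carrier) (4kt+1≈3k : (4 * suc k) × t ⊕ 1# ≈ (suc k * 3) × 1#)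
      (t≲w : ∀ i → t ≲ w i) where

      -- There is no subtraction in the monoid, so 3K copies of `1#` are added to both sides,
      -- rewritten on the left as 4Kt + 1, and cancelled. On the right, 4K + 1 = (K + 1) + 3K.
      4k×E-ones≲k+1 : ∀ i → (4 * suc k) × E (λ X → ones X i) ≲ suc (suc k) × 1#
      4k×E-ones≲k+1 i = ⊕-cancelʳ-≲ ((suc k * 3) × 1#) (begin
        n × u ⊕ (suc k * 3) × 1#            ≈⟨ ⊕-congˡ 4kt+1≈3k ⟨
        n × u ⊕ (n × t ⊕ 1#)                ≈⟨ ⊕-assoc (n × u) (n × t) 1# ⟨
        n × u ⊕ n × t ⊕ 1#                  ≈⟨ ⊕-congʳ (×-distrib-+ u t n) ⟨
        n × (u ⊕ t) ⊕ 1#                    ≲⟨ ⊕-mono-≲ (×-monoʳ-≲ n (⊕-mono-≲ ≲-refl (t≲w i))) ≲-refl ⟩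
        n × (u ⊕ w i) ⊕ 1#                  ≈⟨ ⊕-congʳ (×-congʳ n (E-ones+w i)) ⟩
        n × 1# ⊕ 1#                         ≈⟨ ⊕-comm (n × 1#) 1# ⟩
        suc n × 1#                          ≈⟨ ×-congˡ (split k) ⟩
        (suc (suc k) + suc k * 3) × 1#      ≈⟨ ×-homo-+ 1# (suc (suc k)) (suc k * 3) ⟩
        suc (suc k) × 1# ⊕ (suc k * 3) × 1# ∎)
        where
        n = 4 * suc k
        u : Carrier
        u = E (λ X → ones X i)
        split : ∀ k → 1 + 4 * (1 + k) ≡ 2 + k + (1 + k) * 3
        split = solve-∀

      E-doubleShare≲1 : ∀ A → ∑ (ones A) ≤ suc k → E (doubleShare A 𝟎) ≲ 1#
      E-doubleShare≲1 A s≤k with ∑ (ones A) in eq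
      ... | zero  = ≲-trans (E-mono (doubleShare≤1 A eq)) (≲-reflexive E-1)
      -- The argument is the predecessor of the common factor `suc (suc s) * suc k`.
      ... | suc s = ×-cancelˡ-≲ (k + suc s * suc k) (begin
        (suc (suc s) * suc k) × G            ≈⟨ ×-congˡ (ℕₚ.*-comm (suc (suc s)) (suc k)) ⟩
        (suc k * suc (suc s)) × G            ≈⟨ ×-assocˡ G (suc k) (suc (suc s)) ⟨
        suc k × (suc (suc s) × G)            ≈⟨ ×-congʳ (suc k) (Σμ-* (vertices d) (suc (suc s)) (doubleShare A 𝟎)) ⟨
        suc k × E (λ X → suc (suc s) * doubleShare A 𝟎 X)
                                             ≲⟨ ×-monoʳ-≲ (suc k) (E-mono ([s+1]*doubleShare≤4*shared A eq)) ⟩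
        suc k × E (λ X → 4 * shared A X)     ≈⟨ ×-congʳ (suc k) (Σμ-* (vertices d) 4 (shared A)) ⟩
        suc k × (4 × E (shared A))           ≈⟨ ×-assocˡ (E (shared A)) (suc k) 4 ⟩
        (suc k * 4) × E (shared A)           ≈⟨ ×-congˡ (ℕₚ.*-comm (suc k) 4) ⟩
        (4 * suc k) × E (shared A)           ≲⟨ Σμ-weighted-≲ (vertices d) (4 * suc k) (suc (suc k) × 1#) (ones A) (flip ones)
                                                  4k×E-ones≲k+1 ⟩
        ∑ (ones A) × (suc (suc k) × 1#)      ≈⟨ ×-congˡ eq ⟩
        suc s × (suc (suc k) × 1#)           ≈⟨ ×-assocˡ 1# (suc s) (suc (suc k)) ⟩
        (suc s * suc (suc k)) × 1#           ≲⟨ ×-monoˡ-≲ 0≲1 s[k+1]≤[s+1]k ⟩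
        (suc (suc s) * suc k) × 1#           ∎)
        where
        G : Carrier
        G = E (doubleShare A 𝟎)
        -- Both sides contain the term `suc s * suc k`; what remains is the bound of the number of
        -- ones by the radius.
        s[k+1]≤[s+1]k : suc s * suc (suc k) ≤ suc (suc s) * suc k
        s[k+1]≤[s+1]k = subst (_≤ suc (suc s) * suc k) (sym (ℕₚ.*-suc (suc s) (suc k)))
          (ℕₚ.+-monoˡ-≤ (suc s * suc k) s≤k)

      -- The value `1#` separates the doubled payoffs: that of A is at most `1#`, and that of 𝟎 is
      -- at least `1#` since every X ties.
      payoff-𝟎-maximal : ∀ A → dist 𝟎 A ≤ suc k → payoff A 𝟎 ≲ payoff 𝟎 𝟎
      payoff-𝟎-maximal A dist≤k = ×-cancelˡ-≲ 1 (begin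
        2 × payoff A 𝟎            ≈⟨ 2×payoff A 𝟎 ⟩
        E (doubleShare A 𝟎)       ≲⟨ E-doubleShare≲1 A (subst (_≤ suc k) (dist-𝟎ˡ A) dist≤k) ⟩
        1#                        ≈⟨ E-1 ⟨
        E (λ _ → 1)               ≲⟨ E-mono (1≤doubleShare-diagonal 𝟎) ⟩
        E (doubleShare 𝟎 𝟎)       ≈⟨ 2×payoff 𝟎 𝟎 ⟨
        2 × payoff 𝟎 𝟎            ∎)

-- Natural multiples of rational numbers

module ℚ-+ = CommutativeSemigroupProperties (CommutativeMonoid.commutativeSemigroup ℚₚ.+-0-commutativeMonoid)
module ℚ-× = Mult ℚₚ.+-0-commutativeMonoid

open ℚ-× using () renaming (_×_ to _×ℚ_)

×ℚ-mono-≤ : ∀ n {p q} → p ℚ.≤ q → n ×ℚ p ℚ.≤ n ×ℚ q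
×ℚ-mono-≤ zero    p≤q = ℚₚ.≤-refl
×ℚ-mono-≤ (suc n) p≤q = ℚₚ.+-mono-≤ p≤q (×ℚ-mono-≤ n p≤q)

p≤p+ε : ∀ p {ε} → 0ℚ ℚ.< ε → p ℚ.≤ p ℚ.+ ε
p≤p+ε p {ε} 0<ε = subst (ℚ._≤ p ℚ.+ ε) (ℚₚ.+-identityʳ p) (ℚₚ.+-monoʳ-≤ p (ℚₚ.<⇒≤ 0<ε))

-- The slack survives cancellation unchanged: if q + ε ≤ p, then `suc n` copies of p exceed those of
-- q by at least `suc n` copies of ε, hence by at least ε.
×ℚ-cancel-<-slack : ∀ n p q {ε} → 0ℚ ℚ.< ε →
  suc n ×ℚ p ℚ.< suc n ×ℚ q ℚ.+ ε → p ℚ.< q ℚ.+ ε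
×ℚ-cancel-<-slack n p q {ε} 0<ε np<nq+ε = ℚₚ.≰⇒> λ q+ε≤p →
  ℚₚ.<-irrefl refl (begin-strict
    suc n ×ℚ p                     <⟨ np<nq+ε ⟩
    (q ℚ.+ n ×ℚ q) ℚ.+ ε           ≡⟨ ℚ-+.xy∙z≈xz∙y q (n ×ℚ q) ε ⟩
    (q ℚ.+ ε) ℚ.+ n ×ℚ q           ≤⟨ ℚₚ.+-monoʳ-≤ (q ℚ.+ ε) (×ℚ-mono-≤ n (p≤p+ε q 0<ε)) ⟩
    suc n ×ℚ (q ℚ.+ ε)             ≤⟨ ×ℚ-mono-≤ (suc n) q+ε≤p ⟩
    suc n ×ℚ p                     ∎)
  where open ℚₚ.≤-Reasoning

-- `_/_` reduces to lowest terms, so the sum is compared among unnormalised rationals, by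
-- cross-multiplication.
+-/-same : ∀ a b n → (a ℚ./ suc n) ℚ.+ (b ℚ./ suc n) ≡ (a ℤ.+ b) ℚ./ suc n
+-/-same a b n = ℚₚ.toℚᵘ-injective (begin
  ℚ.toℚᵘ (a ℚ./ suc n ℚ.+ b ℚ./ suc n)
    ≈⟨ ℚₚ.toℚᵘ-homo-+ (a ℚ./ suc n) (b ℚ./ suc n) ⟩
  ℚ.toℚᵘ (a ℚ./ suc n) ℚᵘ.+ ℚ.toℚᵘ (b ℚ./ suc n)
    ≈⟨ ℚᵘₚ.+-cong (ℚₚ.toℚᵘ-fromℚᵘ (ℚᵘ.mkℚᵘ a n)) (ℚₚ.toℚᵘ-fromℚᵘ (ℚᵘ.mkℚᵘ b n)) ⟩
  ℚᵘ.mkℚᵘ a n ℚᵘ.+ ℚᵘ.mkℚᵘ b n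
    ≈⟨ ℚᵘ.*≡* (trans (cong (ℤ._* N) (sym (ℤₚ.*-distribʳ-+ N a b))) (ℤₚ.*-assoc (a ℤ.+ b) N N)) ⟩
  ℚᵘ.mkℚᵘ (a ℤ.+ b) n
    ≈⟨ ℚₚ.toℚᵘ-fromℚᵘ (ℚᵘ.mkℚᵘ (a ℤ.+ b) n) ⟨
  ℚ.toℚᵘ ((a ℤ.+ b) ℚ./ suc n) ∎)
  where
  open import Relation.Binary.Reasoning.Setoid ℚᵘₚ.≃-setoid
  N = ℤ.+ suc n

×ℚ-1/ : ∀ m n → m ×ℚ (ℤ.+ 1 ℚ./ suc n) ≡ ℤ.+ m ℚ./ suc n
×ℚ-1/ zero    n = ℚₚ.fromℚᵘ-cong {ℚᵘ.0ℚᵘ} {ℚᵘ.mkℚᵘ (ℤ.+ 0) n} (ℚᵘ.*≡* refl)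
×ℚ-1/ (suc m) n = trans (cong (ℤ.+ 1 ℚ./ suc n ℚ.+_) (×ℚ-1/ m n)) (+-/-same (ℤ.+ 1) (ℤ.+ m) n)

n×1/n≡1 : ∀ n → suc n ×ℚ (ℤ.+ 1 ℚ./ suc n) ≡ 1ℚ
n×1/n≡1 n = trans (×ℚ-1/ (suc n) n)
  (ℚₚ.fromℚᵘ-cong {ℚᵘ.mkℚᵘ (ℤ.+ suc n) n} {ℚᵘ.1ℚᵘ} (ℚᵘ.*≡* (ℤₚ.*-comm (ℤ.+ suc n) (ℤ.+ 1))))

4k×threshold+1≡3k : ∀ k → (4 * suc k) ×ℚ threshold (suc k) ℚ.+ 1ℚ ≡ (suc k * 3) ×ℚ 1ℚ
4k×threshold+1≡3k k = begin
  n ×ℚ (¾ ℚ.- 1/n) ℚ.+ 1ℚ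
    -- Writing 1 as n copies of 1/n lets it cancel the subtracted term; `k + 3 * suc k` is the
    -- predecessor of n.
    ≡⟨ cong (n ×ℚ (¾ ℚ.- 1/n) ℚ.+_) (n×1/n≡1 (k + 3 * suc k)) ⟨
  n ×ℚ (¾ ℚ.- 1/n) ℚ.+ n ×ℚ 1/n
    ≡⟨ ℚ-×.×-distrib-+ (¾ ℚ.- 1/n) 1/n n ⟨
  n ×ℚ (¾ ℚ.- 1/n ℚ.+ 1/n)
    ≡⟨ cong (n ×ℚ_) (trans (ℚₚ.+-assoc ¾ (ℚ.- 1/n) 1/n)
         (trans (cong (¾ ℚ.+_) (ℚₚ.+-inverseˡ 1/n)) (ℚₚ.+-identityʳ ¾))) ⟩
  n ×ℚ ¾
    ≡⟨ cong (_×ℚ ¾) (ℕₚ.*-comm 4 (suc k)) ⟩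
  (suc k * 4) ×ℚ ¾
    ≡⟨ ℚ-×.×-assocˡ ¾ (suc k) 4 ⟨
  -- Four copies of ¾ and three copies of 1 evaluate to the same rational.
  suc k ×ℚ (3 ×ℚ 1ℚ)
    ≡⟨ ℚ-×.×-assocˡ 1ℚ (suc k) 3 ⟩
  (suc k * 3) ×ℚ 1ℚ ∎
  where
  open ≡-Reasoning
  n = 4 * suc k
  ¾ 1/n : ℚ
  ¾ = ℤ.+ 3 ℚ./ 4
  1/n = ℤ.+ 1 ℚ./ n

-- The real numbers

half-positive : ∀ {ε} → 0ℚ ℚ.< ε → 0ℚ ℚ.< ½ ℚ.* ε
half-positive {ε} 0<ε = ℚₚ.positive⁻¹ (½ ℚ.* ε) {{ℚₚ.pos*pos⇒pos ½ ε {{ℚ.positive 0<ε}}}}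

half+half : ∀ p → ½ ℚ.* p ℚ.+ ½ ℚ.* p ≡ p
half+half p = trans (sym (ℚₚ.*-distribʳ-+ p ½ ½)) (ℚₚ.*-identityˡ p)

termwise-≤⇒≤ᴿ : ∀ x y → (∀ n → seq x n ℚ.≤ seq y n) → x ≤ᴿ y
termwise-≤⇒≤ᴿ x y x≤y ε 0<ε = 0 , λ n _ →
  subst (ℚ._< seq y n ℚ.+ ε) (ℚₚ.+-identityʳ (seq x n)) (ℚₚ.+-mono-≤-< (x≤y n) 0<ε)

≤ᴿ-trans : ∀ x y z → x ≤ᴿ y → y ≤ᴿ z → x ≤ᴿ z
≤ᴿ-trans x y z x≤y y≤z ε 0<ε
  with x≤y (½ ℚ.* ε) (half-positive 0<ε) | y≤z (½ ℚ.* ε) (half-positive 0<ε)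
... | M , p | N , q = M ⊔ N , λ n M⊔N≤n → begin-strict
  seq x n                            <⟨ p n (ℕₚ.m⊔n≤o⇒m≤o M N M⊔N≤n) ⟩
  seq y n ℚ.+ δ                      <⟨ ℚₚ.+-monoˡ-< δ (q n (ℕₚ.m⊔n≤o⇒n≤o M N M⊔N≤n)) ⟩
  seq z n ℚ.+ δ ℚ.+ δ                ≡⟨ ℚₚ.+-assoc (seq z n) δ δ ⟩
  seq z n ℚ.+ (δ ℚ.+ δ)              ≡⟨ cong (seq z n ℚ.+_) (half+half ε) ⟩
  seq z n ℚ.+ ε                      ∎
  where
  open ℚₚ.≤-Reasoning
  δ = ½ ℚ.* ε

+ᴿ-mono-≤ : ∀ x y u v → x ≤ᴿ y → u ≤ᴿ v → x +ᴿ u ≤ᴿ y +ᴿ v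
+ᴿ-mono-≤ x y u v x≤y u≤v ε 0<ε
  with x≤y (½ ℚ.* ε) (half-positive 0<ε) | u≤v (½ ℚ.* ε) (half-positive 0<ε)
... | M , p | N , q = M ⊔ N , λ n M⊔N≤n → begin-strict
  seq x n ℚ.+ seq u n
    <⟨ ℚₚ.+-mono-< (p n (ℕₚ.m⊔n≤o⇒m≤o M N M⊔N≤n)) (q n (ℕₚ.m⊔n≤o⇒n≤o M N M⊔N≤n)) ⟩
  (seq y n ℚ.+ δ) ℚ.+ (seq v n ℚ.+ δ)
    ≡⟨ ℚ-+.interchange (seq y n) δ (seq v n) δ ⟩
  (seq y n ℚ.+ seq v n) ℚ.+ (δ ℚ.+ δ)
    ≡⟨ cong (seq y n ℚ.+ seq v n ℚ.+_) (half+half ε) ⟩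
  (seq y n ℚ.+ seq v n) ℚ.+ ε ∎
  where
  open ℚₚ.≤-Reasoning
  δ = ½ ℚ.* ε

+ᴿ-cancelʳ-≤ : ∀ x y z → x +ᴿ z ≤ᴿ y +ᴿ z → x ≤ᴿ y
+ᴿ-cancelʳ-≤ x y z x+z≤y+z ε 0<ε with x+z≤y+z ε 0<ε
... | N , p = N , λ n N≤n → ℚₚ.≰⇒> λ y+ε≤x → ℚₚ.<-irrefl refl (begin-strict
  seq x n ℚ.+ seq z n                <⟨ p n N≤n ⟩
  seq y n ℚ.+ seq z n ℚ.+ ε          ≡⟨ ℚ-+.xy∙z≈xz∙y (seq y n) (seq z n) ε ⟩
  seq y n ℚ.+ ε ℚ.+ seq z n          ≤⟨ ℚₚ.+-monoˡ-≤ (seq z n) y+ε≤x ⟩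
  seq x n ℚ.+ seq z n                ∎)
  where open ℚₚ.≤-Reasoning

infix 4 _≃_

-- Equality as order in both directions, so that its laws follow from those of `_≤ᴿ_`.
_≃_ : ℝ → ℝ → Set
x ≃ y = x ≤ᴿ y Product.× y ≤ᴿ x

termwise-≡⇒≃ : ∀ x y → (∀ n → seq x n ≡ seq y n) → x ≃ y
termwise-≡⇒≃ x y x≡y =
  termwise-≤⇒≤ᴿ x y (ℚₚ.≤-reflexive ∘ x≡y) , termwise-≤⇒≤ᴿ y x (ℚₚ.≤-reflexive ∘ sym ∘ x≡y)

p≤∣p∣ : ∀ p → p ℚ.≤ ℚ.∣ p ∣
p≤∣p∣ p with ℚₚ.≤-total 0ℚ p
... | inj₁ 0≤p = ℚₚ.≤-reflexive (sym (ℚₚ.0≤p⇒∣p∣≡p 0≤p))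
... | inj₂ p≤0 = ℚₚ.≤-trans p≤0 (ℚₚ.0≤∣p∣ p)

∣p-q∣≡∣q-p∣ : ∀ p q → ℚ.∣ p ℚ.- q ∣ ≡ ℚ.∣ q ℚ.- p ∣
∣p-q∣≡∣q-p∣ p q = trans (sym (ℚₚ.∣-p∣≡∣p∣ (p ℚ.- q))) (cong ℚ.∣_∣ (⁻¹-anti-homo-// p q))
  where open GroupProperties ℚₚ.+-0-group

∣p-q∣<ε⇒p<q+ε : ∀ p q {ε} → ℚ.∣ p ℚ.- q ∣ ℚ.< ε → p ℚ.< q ℚ.+ ε
∣p-q∣<ε⇒p<q+ε p q {ε} ∣p-q∣<ε = begin-strict
  p                        ≡⟨ ℚₚ.+-identityʳ p ⟨
  p ℚ.+ 0ℚ                 ≡⟨ cong (p ℚ.+_) (ℚₚ.+-inverseˡ q) ⟨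
  p ℚ.+ (ℚ.- q ℚ.+ q)      ≡⟨ ℚ-+.x∙yz≈z∙xy p (ℚ.- q) q ⟩
  q ℚ.+ (p ℚ.- q)          ≤⟨ ℚₚ.+-monoʳ-≤ q (p≤∣p∣ (p ℚ.- q)) ⟩
  q ℚ.+ ℚ.∣ p ℚ.- q ∣      <⟨ ℚₚ.+-monoʳ-< q ∣p-q∣<ε ⟩
  q ℚ.+ ε                  ∎
  where open ℚₚ.≤-Reasoning

-- Carries the hypothesis `total`, stated with `_≈ᴿ_`, over to the equality of the ordered monoid.
≈ᴿ⇒≃ : ∀ x y → x ≈ᴿ y → x ≃ y
≈ᴿ⇒≃ x y x≈y =
  (λ ε 0<ε → Product.map₂ (λ p n N≤n → ∣p-q∣<ε⇒p<q+ε (seq x n) (seq y n) (p n N≤n)) (x≈y ε 0<ε)) ,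
  (λ ε 0<ε → Product.map₂ (λ p n N≤n → ∣p-q∣<ε⇒p<q+ε (seq y n) (seq x n)
    (subst (ℚ._< ε) (∣p-q∣≡∣q-p∣ (seq x n) (seq y n)) (p n N≤n))) (x≈y ε 0<ε))

≃-isEquivalence : IsEquivalence _≃_
≃-isEquivalence = record
  { refl  = λ {x} → termwise-≡⇒≃ x x λ _ → refl
  ; sym   = Product.swap
  ; trans = λ {x} {y} {z} → Product.zip (≤ᴿ-trans x y z) (flip (≤ᴿ-trans z y x))
  }

-- The reals as an ordered commutative monoid

+ᴿ-0-commutativeMonoid : CommutativeMonoid 0ℓ 0ℓ
+ᴿ-0-commutativeMonoid = record
  { Carrier = ℝ ; _≈_ = _≃_ ; _∙_ = _+ᴿ_ ; ε = 0ᴿ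
  ; isCommutativeMonoid = record
    { isMonoid = record
      { isSemigroup = record
        { isMagma = record
          { isEquivalence = ≃-isEquivalence
          ; ∙-cong = λ {x} {y} {u} {v} → Product.zip (+ᴿ-mono-≤ x y u v) (+ᴿ-mono-≤ y x v u)
          }
        ; assoc = λ x y z → termwise-≡⇒≃ (x +ᴿ y +ᴿ z) (x +ᴿ (y +ᴿ z))
            λ n → ℚₚ.+-assoc (seq x n) (seq y n) (seq z n)
        }
      ; identity =
          (λ x → termwise-≡⇒≃ (0ᴿ +ᴿ x) x λ n → ℚₚ.+-identityˡ (seq x n)) ,
          (λ x → termwise-≡⇒≃ (x +ᴿ 0ᴿ) x λ n → ℚₚ.+-identityʳ (seq x n))
      }
    ; comm = λ x y → termwise-≡⇒≃ (x +ᴿ y) (y +ᴿ x) λ n → ℚₚ.+-comm (seq x n) (seq y n)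
    }
  }

open Mult +ᴿ-0-commutativeMonoid using () renaming (_×_ to _×ᴿ_)

seq-×ᴿ : ∀ m x n → seq (m ×ᴿ x) n ≡ m ×ℚ seq x n
seq-×ᴿ zero    x n = refl
seq-×ᴿ (suc m) x n = cong (seq x n ℚ.+_) (seq-×ᴿ m x n)

×ᴿ-cancelˡ-≤ : ∀ m x y → suc m ×ᴿ x ≤ᴿ suc m ×ᴿ y → x ≤ᴿ y
×ᴿ-cancelˡ-≤ m x y mx≤my ε 0<ε =
  Product.map₂ (λ p n N≤n → ×ℚ-cancel-<-slack m (seq x n) (seq y n) 0<ε
    (subst₂ (λ a b → a ℚ.< b ℚ.+ ε) (seq-×ᴿ (suc m) x n) (seq-×ᴿ (suc m) y n) (p n N≤n)))
    (mx≤my ε 0<ε)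

ℝ-orderedMonoid : OrderedMonoid
ℝ-orderedMonoid = record
  { commutativeMonoid = +ᴿ-0-commutativeMonoid
  ; _≲_         = _≤ᴿ_
  ; isPreorder  = record
    { isEquivalence = ≃-isEquivalence
    ; reflexive     = proj₁
    ; trans         = λ {x} {y} {z} → ≤ᴿ-trans x y z
    }
  ; ⊕-mono-≲    = λ {x} {y} {u} {v} → +ᴿ-mono-≤ x y u v
  ; ⊕-cancelʳ-≲ = λ {x} {y} → +ᴿ-cancelʳ-≤ x y
  ; ×-cancelˡ-≲ = λ m {x} {y} → ×ᴿ-cancelˡ-≤ m x y
  ; half        = ½ ·ᴿ_
  -- The multiple by 2 unfolds with a trailing zero, which is removed first.
  ; 2×half      = λ x → termwise-≡⇒≃ (2 ×ᴿ (½ ·ᴿ x)) x λ n →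
      trans (cong (½ ℚ.* seq x n ℚ.+_) (ℚₚ.+-identityʳ (½ ℚ.* seq x n))) (half+half (seq x n))
  }

-- The payoff bound over the reals, for both players

4k×thresholdᴿ+1≃3k : ∀ k → (4 * suc k) ×ᴿ fromℚ (threshold (suc k)) +ᴿ 1ᴿ ≃ (suc k * 3) ×ᴿ 1ᴿ
4k×thresholdᴿ+1≃3k k =
  termwise-≡⇒≃ ((4 * suc k) ×ᴿ fromℚ (threshold (suc k)) +ᴿ 1ᴿ) ((suc k * 3) ×ᴿ 1ᴿ) λ n →
    trans (cong (ℚ._+ 1ℚ) (seq-×ᴿ (4 * suc k) (fromℚ (threshold (suc k))) n))
      (trans (4k×threshold+1≡3k k) (sym (seq-×ᴿ (suc k * 3) 1ᴿ n)))

-- The tie conditions differ only in the orientation of an equation, so they filter out the same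
-- list and the payoffs are identical, not merely equal as reals.
P₂≡P₁ : ∀ {d} (μ : Q d → ℝ) A B → P₂ μ A B ≡ P₁ μ B A
P₂≡P₁ {d} μ A B = cong (λ L → mass μ (V? B A) +ᴿ ½ ·ᴿ sumᴿ (List.map μ L))
  (filter-≐ (T? A B) (T? B A) (sym , sym) (vertices d))

P₁-𝟎-maximal : ∀ {d} k (μ : Q d → ℝ) → IsProbability μ →
  (∀ i → w⁰ μ i ≥ᴿ fromℚ (threshold (suc k))) →
  ∀ A → dist 𝟎 A ≤ suc k → P₁ μ 𝟎 𝟎 ≥ᴿ P₁ μ A 𝟎
P₁-𝟎-maximal {d} k μ isProb w≥t =
  Payoffs.payoff-𝟎-maximal ℝ-orderedMonoid μ nonNeg {1ᴿ}
    (termwise-≤⇒≤ᴿ 0ᴿ 1ᴿ λ _ → ℚₚ.<⇒≤ (ℚₚ.positive⁻¹ 1ℚ))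
    (≈ᴿ⇒≃ (sumᴿ (List.map μ (vertices d))) 1ᴿ total)
    k (fromℚ (threshold (suc k))) (4k×thresholdᴿ+1≃3k k) w≥t
  where open IsProbability isProb

mainTheorem4 : (d k : ℕ) .{{_ : NonZero k}} → k ≤ d →
    (μ : Q d → ℝ) → IsProbability μ →
    ((i : Fin d) → w⁰ μ i ≥ᴿ fromℚ (threshold k)) →
    IsLocalEquilibrium k μ 𝟎 𝟎
mainTheorem4 d (suc k) _ μ isProb w≥t =
  P₁-𝟎-maximal k μ isProb w≥t ,
  -- By symmetry a deviation of the second player is one of the first player against 𝟎.
  λ B dist≤k → subst₂ _≥ᴿ_ (sym (P₂≡P₁ μ 𝟎 𝟎)) (sym (P₂≡P₁ μ 𝟎 B)) (P₁-𝟎-maximal k μ isProb w≥t B dist≤k)
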